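{- Let $f,g:\{0,1\}^n\to\{0,1\}$ be Boolean functions. If $f$ is PN-equivalent to $g$, then $f$ and $g$ have the same ordered influence vector: $OIV(f)=OIV(g)$.
   Context: For a word $X=(x_1,\dots,x_n)\in\{0,1\}^n$, $X^i$ denotes $X$ with its $i$-th bit negated. A selective negation $(\neg)$ is a map $\{0,1\}^n\to\{0,1\}^n$ that negates the bits in some fixed set of positions and leaves the others unchanged. A permutation $\pi$ acts on words by reordering their entries. $f$ is PN-equivalent to $g$ if there are a permutation $\pi$ and a selective negation $(\neg)$ with $f(\pi((\neg)X))=g(X)$ for all $X\in\{0,1\}^n$. The influence of input $i$ on $f$ is (with the normalization used here) $inf(f,i)=\frac12\,|\{X\in\{0,1\}^n : f(X)\neq f(X^i)\}|$. The ordered influence vector is $OIV(f)=\{inf(f,i): i\in\{1,\dots,n\}\}_\le$, where $\{\cdot\}_\le$ denotes the multiset (with multiplicities) listed in non-decreasing order. -}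

module Defs where

open import Data.Bool using (Bool; true; false; not; if_then_else_; _≟_)
open import Data.Fin using (Fin)
open import Data.Fin.Permutation using (Permutation′; _⟨$⟩ʳ_)
open import Data.Fin.Subset using (Subset)
open import Data.Integer using (+_)
open import Data.List using (List; []; _∷_; _++_; map; filter; length; allFin)
open import Data.List.Sort using (sort)
open import Data.Nat using (ℕ; zero; suc)
open import Data.Product using (∃₂)
open import Data.Rational using (ℚ; _/_)
open import Data.Rational.Properties using (≤-decTotalOrder)
open import Data.Vec as Vec using (Vec; lookup; tabulate; zipWith; updateAt)
open import Relation.Binary.PropositionalEquality using (_≡_)
open import Relation.Nullary.Decidable using (¬?)

Word : ℕ → Set
Word n = Vec Bool n

BoolFun : ℕ → Set
BoolFun n = Word n → Bool

negateAt : ∀ {n} → Word n → Fin n → Word n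
negateAt X i = updateAt X i not

negateOn : ∀ {n} → Subset n → Word n → Word n
negateOn = zipWith (λ s x → if s then not x else x)

-- Entry i of the permuted word is x_{π(i)}. The opposite convention x_{π⁻¹(i)}
-- yields the same PN-equivalence, which quantifies over all permutations.
permute : ∀ {n} → Permutation′ n → Word n → Word n
permute π X = tabulate (λ i → lookup X (π ⟨$⟩ʳ i))

PNEquivalent : ∀ {n} → BoolFun n → BoolFun n → Set
PNEquivalent {n} f g =
  ∃₂ λ (π : Permutation′ n) (S : Subset n) →
    ∀ (X : Word n) → f (permute π (negateOn S X)) ≡ g X

-- Each word of length n occurs exactly once, so lengths of filtered sublists
-- are cardinalities of the corresponding sets of words.
words : ∀ n → List (Word n)
words zero    = Vec.[] ∷ []
words (suc n) = map (false Vec.∷_) (words n) ++ map (true Vec.∷_) (words n)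

inf : ∀ {n} → BoolFun n → Fin n → ℚ
inf {n} f i =
  + length (filter (λ X → ¬? (f X ≟ f (negateAt X i))) (words n)) / 2

OIV : ∀ {n} → BoolFun n → List ℚ
OIV {n} f = sort ≤-decTotalOrder (map (inf f) (allFin n))

{-# OPTIONS --safe #-}

-- The map φ = permute π ∘ negateOn S is a bijection of the words, and it turns
-- negation of bit π(i) into negation of bit i. Since g = f ∘ φ, the words counted
-- by inf(g, π(i)) are the φ-preimages of those counted by inf(f, i). Hence
-- inf(g, π(i)) = inf(f, i), so the two influence vectors are rearrangements
-- of each other and agree after sorting.
module Submission where

open import Defs
open import Data.Bool using (true; false; not; _≟_)
open import Data.Bool.Properties using (not-involutive)
open import Data.Fin using (Fin; zero; suc)
import Data.Fin.Properties as Fin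
open import Data.Fin.Permutation using (Permutation′; _⟨$⟩ʳ_; _⟨$⟩ˡ_; inverseʳ; flip)
open import Data.Fin.Subset using (Subset)
open import Data.Integer using (+_)
open import Data.List using (List; []; _∷_; map; filter; length; allFin)
open import Data.List.Properties using (filter-≐; map-cong; map-∘)
open import Data.List.Membership.Propositional using (_∈_)
open import Data.List.Membership.Propositional.Properties using (∈-map⁺; ∈-map⁻; ∈-++⁺ˡ; ∈-++⁺ʳ; ∈-allFin)
open import Data.List.Membership.Propositional.Properties.WithK using (unique∧set⇒bag)
open import Data.List.Relation.Binary.BagAndSetEquality using (∼bag⇒↭)
open import Data.List.Relation.Binary.Disjoint.Propositional using (Disjoint)
open import Data.List.Relation.Binary.Permutation.Propositional using (_↭_; ↭-reflexive; ↭-sym; ↭-trans; ↭⇒↭ₛ)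
import Data.List.Relation.Binary.Permutation.Propositional.Properties as Perm
open import Data.List.Relation.Binary.Pointwise using (Pointwise-≡⇒≡)
open import Data.List.Relation.Unary.Any using (here)
open import Data.List.Relation.Unary.Sorted.TotalOrder.Properties using (↗↭↗⇒≋)
import Data.List.Relation.Unary.All as All
import Data.List.Relation.Unary.AllPairs as AllPairs
open import Data.List.Relation.Unary.Unique.Propositional using (Unique)
import Data.List.Relation.Unary.Unique.Propositional.Properties as Unique
open import Data.List.Sort using (sort; sort-↭; sort-↗)
open import Data.Nat using (ℕ; zero; suc)
open import Data.Product using (_,_)
open import Data.Rational using (ℚ; _/_)
open import Data.Rational.Properties using (≤-decTotalOrder)
open import Data.Vec as Vec using (lookup)
open import Data.Vec.Properties using (∷-injectiveʳ; lookup∘tabulate; lookup∘updateAt; lookup∘updateAt′; tabulate∘lookup; tabulate-cong)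
open import Function using (_∘_; _↔_; mk↔ₛ′; mk⇔; Injection; Inverse)
open import Function.Construct.Composition using (_↔-∘_)
open import Function.Properties.Inverse using (↔⇒↣)
open import Relation.Binary using (DecTotalOrder)
open import Relation.Binary.PropositionalEquality using (_≡_; refl; sym; trans; cong; cong₂; subst; module ≡-Reasoning)
open import Relation.Nullary using (yes; no; does)
open import Relation.Nullary.Decidable using (¬?)
open import Relation.Unary using (Pred; Decidable)

private
  variable
    n : ℕ

-- Both sorted lists are rearrangements of one another, and a total order admits only one sorted
-- arrangement up to its underlying equivalence, which on `ℚ` is propositional equality.
sort-cong-↭ : {xs ys : List ℚ} → xs ↭ ys →
              sort ≤-decTotalOrder xs ≡ sort ≤-decTotalOrder ys
sort-cong-↭ {xs} {ys} xs↭ys = Pointwise-≡⇒≡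
  (↗↭↗⇒≋ (DecTotalOrder.totalOrder ≤-decTotalOrder)
    (sort-↗ ≤-decTotalOrder xs) (sort-↗ ≤-decTotalOrder ys)
    (↭⇒↭ₛ (↭-trans (sort-↭ ≤-decTotalOrder xs)
            (↭-trans xs↭ys (↭-sym (sort-↭ ≤-decTotalOrder ys))))))

length-filter-map : ∀ {a b p} {A : Set a} {B : Set b} {P : Pred B p}
                    (P? : Decidable P) (h : A → B) xs →
                    length (filter P? (map h xs)) ≡ length (filter (P? ∘ h) xs)
length-filter-map P? h []       = refl
length-filter-map P? h (x ∷ xs) with does (P? (h x))
... | true  = cong suc (length-filter-map P? h xs)
... | false = length-filter-map P? h xs

-- Both lists are duplicate-free and contain every element of `A`, so they agree as sets and
-- therefore as bags. It serves twice: for the words under `φ` and for the indices under `π`.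
map-↔-↭ : ∀ {a} {A : Set a} (φ : A ↔ A) {xs : List A} →
          Unique xs → (∀ x → x ∈ xs) → map (Inverse.to φ) xs ↭ xs
map-↔-↭ φ {xs} unique complete = ∼bag⇒↭ (unique∧set⇒bag
  (Unique.map⁺ (Injection.injective (↔⇒↣ φ)) unique) unique
  (λ {y} → mk⇔ (λ _ → complete y)
               (λ _ → subst (_∈ map to xs) (strictlyInverseˡ y) (∈-map⁺ to (complete (from y))))))
  where
  open Inverse φ using (to; from; strictlyInverseˡ)

-- Together with `words-unique`, this makes `map-↔-↭` applicable to `words n`.
words-complete : (X : Word n) → X ∈ words n
words-complete Vec.[]          = here refl
words-complete (false Vec.∷ X) = ∈-++⁺ˡ (∈-map⁺ (false Vec.∷_) (words-complete X))
words-complete (true  Vec.∷ X) = ∈-++⁺ʳ _ (∈-map⁺ (true Vec.∷_) (words-complete X))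

words-unique : ∀ n → Unique (words n)
words-unique zero    = All.[] AllPairs.∷ AllPairs.[]
words-unique (suc n) = Unique.++⁺
  (Unique.map⁺ ∷-injectiveʳ (words-unique n))
  (Unique.map⁺ ∷-injectiveʳ (words-unique n))
  disjoint
  where
  disjoint : Disjoint (map (false Vec.∷_) (words n)) (map (true Vec.∷_) (words n))
  disjoint (p , q) with ∈-map⁻ (false Vec.∷_) p | ∈-map⁻ (true Vec.∷_) q
  ... | _ , _ , refl | _ , _ , ()

lookup-extensional : (X Y : Word n) → (∀ i → lookup X i ≡ lookup Y i) → X ≡ Y
lookup-extensional X Y eq =
  trans (sym (tabulate∘lookup X)) (trans (tabulate-cong eq) (tabulate∘lookup Y))

permute-flip : (π : Permutation′ n) (X : Word n) → permute (flip π) (permute π X) ≡ X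
permute-flip π X = trans
  (tabulate-cong (λ i → trans (lookup∘tabulate _ (π ⟨$⟩ˡ i)) (cong (lookup X) (inverseʳ π))))
  (tabulate∘lookup X)

-- One lemma gives both inverse laws, since `flip (flip π)` acts as `π` by computation.
permute↔ : Permutation′ n → Word n ↔ Word n
permute↔ π = mk↔ₛ′ (permute π) (permute (flip π)) (permute-flip (flip π)) (permute-flip π)

negateOn-involutive : (S : Subset n) (X : Word n) → negateOn S (negateOn S X) ≡ X
negateOn-involutive Vec.[]          Vec.[]      = refl
negateOn-involutive (true  Vec.∷ S) (x Vec.∷ X) = cong₂ Vec._∷_ (not-involutive x) (negateOn-involutive S X)
negateOn-involutive (false Vec.∷ S) (x Vec.∷ X) = cong (x Vec.∷_) (negateOn-involutive S X)

negateOn↔ : Subset n → Word n ↔ Word n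
negateOn↔ S = mk↔ₛ′ (negateOn S) (negateOn S) (negateOn-involutive S) (negateOn-involutive S)

-- Both operations act bit by bit, and the bit at `i` receives the same number of negations in
-- either order.
negateOn-negateAt : (S : Subset n) (X : Word n) (i : Fin n) →
                    negateOn S (negateAt X i) ≡ negateAt (negateOn S X) i
negateOn-negateAt (true  Vec.∷ S) (x Vec.∷ X) zero    = refl
negateOn-negateAt (false Vec.∷ S) (x Vec.∷ X) zero    = refl
negateOn-negateAt (s     Vec.∷ S) (x Vec.∷ X) (suc i) = cong (_ Vec.∷_) (negateOn-negateAt S X i)

-- Entry `i` of the permuted word is read from position `π ⟨$⟩ʳ i`, so that position is the one to
-- negate beforehand.
permute-negateAt : (π : Permutation′ n) (X : Word n) (i : Fin n) →
                   permute π (negateAt X (π ⟨$⟩ʳ i)) ≡ negateAt (permute π X) i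
permute-negateAt π X i = lookup-extensional _ _ pointwise
  where
  open ≡-Reasoning

  pointwise : ∀ j → lookup (permute π (negateAt X (π ⟨$⟩ʳ i))) j ≡ lookup (negateAt (permute π X) i) j
  pointwise j with j Fin.≟ i
  ... | yes refl = begin
    lookup (permute π (negateAt X (π ⟨$⟩ʳ i))) i  ≡⟨ lookup∘tabulate _ i ⟩
    lookup (negateAt X (π ⟨$⟩ʳ i)) (π ⟨$⟩ʳ i)     ≡⟨ lookup∘updateAt (π ⟨$⟩ʳ i) X ⟩
    not (lookup X (π ⟨$⟩ʳ i))                     ≡⟨ cong not (lookup∘tabulate _ i) ⟨
    not (lookup (permute π X) i)                  ≡⟨ lookup∘updateAt i (permute π X) ⟨
    lookup (negateAt (permute π X) i) i           ∎
  -- Injectivity of `π` keeps the position read by `j` apart from the negated one.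
  ... | no j≢i = begin
    lookup (permute π (negateAt X (π ⟨$⟩ʳ i))) j  ≡⟨ lookup∘tabulate _ j ⟩
    lookup (negateAt X (π ⟨$⟩ʳ i)) (π ⟨$⟩ʳ j)     ≡⟨ lookup∘updateAt′ (π ⟨$⟩ʳ j) (π ⟨$⟩ʳ i) (j≢i ∘ Injection.injective (↔⇒↣ π)) X ⟩
    lookup X (π ⟨$⟩ʳ j)                           ≡⟨ lookup∘tabulate _ j ⟨
    lookup (permute π X) j                        ≡⟨ lookup∘updateAt′ j i j≢i (permute π X) ⟨
    lookup (negateAt (permute π X) i) j           ∎

inf-↔ : {f g : BoolFun n} (φ : Word n ↔ Word n) {i j : Fin n} →
        (∀ X → f (Inverse.to φ X) ≡ g X) →
        (∀ X → Inverse.to φ (negateAt X j) ≡ negateAt (Inverse.to φ X) i) →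
        inf f i ≡ inf g j
inf-↔ {n} {f} {g} φ {i} {j} f∘φ≡g φ-negateAt = cong (λ k → + k / 2) (begin
  length (filter sensitive? (words n))
    -- Running through the words along `φ` merely reorders them, which leaves the count unchanged.
    ≡⟨ Perm.↭-length (Perm.filter-↭ sensitive? (map-↔-↭ φ (words-unique n) words-complete)) ⟨
  length (filter sensitive? (map to (words n)))
    ≡⟨ length-filter-map sensitive? to (words n) ⟩
  length (filter (sensitive? ∘ to) (words n))
    -- The two predicates are negated equations whose corresponding sides agree by `f∘φ≡g` and
    -- `f-negated`; each implication carries an equation back across these to a contradiction.
    ≡⟨ cong length (filter-≐ _ _
         ( (λ {X} f≢ g≡ → f≢ (trans (f∘φ≡g X) (trans g≡ (sym (f-negated X)))))
         , (λ {X} g≢ f≡ → g≢ (trans (sym (f∘φ≡g X)) (trans f≡ (f-negated X))))) (words n)) ⟩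
  length (filter (λ X → ¬? (g X ≟ g (negateAt X j))) (words n)) ∎)
  where
  open ≡-Reasoning
  open Inverse φ using (to)

  sensitive? = λ X → ¬? (f X ≟ f (negateAt X i))

  f-negated : ∀ X → f (negateAt (to X) i) ≡ g (negateAt X j)
  f-negated X = trans (cong f (sym (φ-negateAt X))) (f∘φ≡g (negateAt X j))

theorem1 : ∀ (n : ℕ) (f g : BoolFun n) → PNEquivalent f g → OIV f ≡ OIV g
theorem1 n f g (π , S , f∘φ≡g) = sort-cong-↭
  -- The influences of `f` are literally those of `g` listed along `π`; since `π` only reorders
  -- `allFin n`, mapping `inf g` over it yields a rearrangement.
  (↭-trans (↭-reflexive (trans (map-cong inf-π (allFin n)) (map-∘ (allFin n))))
           (Perm.map⁺ (inf g) (map-↔-↭ π (Unique.allFin⁺ n) ∈-allFin)))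
  where
  inf-π : ∀ i → inf f i ≡ inf g (π ⟨$⟩ʳ i)
  inf-π i = inf-↔ (permute↔ π ↔-∘ negateOn↔ S) f∘φ≡g
    -- Negation at `π ⟨$⟩ʳ i` passes through `negateOn S` at the same position, and `permute π` then
    -- moves it to `i`.
    (λ X → trans (cong (permute π) (negateOn-negateAt S X (π ⟨$⟩ʳ i)))
                 (permute-negateAt π (negateOn S X) i))
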